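{- Let $q$ be an odd prime power and let $\gamma\in\mathbb{F}_{q^2}$. The polynomial $f(x)=x+\gamma\,\mathrm{Tr}\left(x^3-x^{q+2}\right)$ over $\mathbb{F}_{q^2}$ is a permutation polynomial if and only if $\gamma\in\mathbb{F}_q$ and $-2\gamma$ is a square of $\mathbb{F}_q$.
   Context: $\mathrm{Tr}:\mathbb{F}_{q^2}\to\mathbb{F}_q$ is the trace map $\mathrm{Tr}(x)=x+x^q$. A polynomial $f$ over $\mathbb{F}_{q^2}$ is a permutation polynomial if the map $x\mapsto f(x)$ is a bijection of $\mathbb{F}_{q^2}$ onto itself. An element $a\in\mathbb{F}_q$ is a square of $\mathbb{F}_q$ if $a=s^2$ for some $s\in\mathbb{F}_q$ (so $0$ is a square). -}

module Defs where

open import Algebra.Bundles using (CommutativeRing; Semiring)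
open import Algebra.Definitions using (Invertible)
import Algebra.Definitions.RawSemiring as RawSemiringDefs
open import Algebra.Morphism.Structures using (module RingMorphisms)
open import Data.Fin.Base using (Fin)
open import Data.Nat.Base as ℕ using (ℕ; NonZero)
open import Data.Nat.Divisibility using (_∤_)
open import Data.Nat.Primality using (Prime)
open import Data.Product.Base using (_×_; ∃-syntax)
open import Function.Bundles using (Inverse)
open import Function.Definitions using (Bijective)
open import Level using (Level; suc; _⊔_)
open import Relation.Binary.PropositionalEquality.Core using (_≡_)
open import Relation.Binary.PropositionalEquality.Properties using (setoid)
open import Relation.Nullary.Negation using (¬_)

IsPrimePower : ℕ → Set
IsPrimePower q = ∃[ p ] ∃[ k ] (Prime p × NonZero k × q ≡ p ℕ.^ k)

IsOddPrimePower : ℕ → Set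
IsOddPrimePower q = IsPrimePower q × 2 ∤ q

-- A field with exactly n elements, counted up to its setoid equality.
record FiniteField (c ℓ : Level) (n : ℕ) : Set (suc (c ⊔ ℓ)) where
  field
    commutativeRing : CommutativeRing c ℓ

  open CommutativeRing commutativeRing public
    renaming (setoid to ≈-setoid)

  field
    0≉1         : ¬ (0# ≈ 1#)
    invertible  : ∀ x → ¬ (x ≈ 0#) → Invertible _≈_ 1# _*_ x
    enumeration : Inverse ≈-setoid (setoid (Fin n))

  open RawSemiringDefs (Semiring.rawSemiring semiring) public
    using (_^_)
    renaming (_×_ to _·_)

  IsSquare : Carrier → Set (c ⊔ ℓ)
  IsSquare a = ∃[ s ] (a ≈ s ^ 2)

  IsPermutation : (Carrier → Carrier) → Set (c ⊔ ℓ)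
  IsPermutation = Bijective _≈_ _≈_

-- An embedding of fields; injectivity is automatic.
IsEmbedding : ∀ {c₁ ℓ₁ c₂ ℓ₂ m n} (K : FiniteField c₁ ℓ₁ m) (L : FiniteField c₂ ℓ₂ n) →
              (FiniteField.Carrier K → FiniteField.Carrier L) → Set (c₁ ⊔ ℓ₁ ⊔ ℓ₂)
IsEmbedding K L = RingMorphisms.IsRingHomomorphism
  (CommutativeRing.rawRing (FiniteField.commutativeRing K))
  (CommutativeRing.rawRing (FiniteField.commutativeRing L))

module _ {c ℓ : Level} (q : ℕ) (L : FiniteField c ℓ (q ℕ.^ 2)) where
  open FiniteField L

  -- The trace to the subfield with q elements, with its values regarded as
  -- elements of the large field.
  Tr : Carrier → Carrier
  Tr x = x + x ^ q

  f : Carrier → Carrier → Carrier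
  f γ x = x + γ * Tr (x ^ 3 - x ^ (q ℕ.+ 2))

module Submission where

-- Write x̄ = x ^ q. Then f x = x + γ (x - x̄)² (x + x̄).
--
-- If G = γ - γ̄ ≠ 0, then x = -(G⁻² + γ + γ̄)/2 satisfies f x = f (x + γ) = x. If γ = γ̄, then
-- f preserves D = x - x̄ and multiplies x + x̄ by 1 + 2γD², so f is a permutation if and only
-- if 1 + 2γD² ≠ 0 whenever D̄ = -D. As the squares of these D ≠ 0 are exactly the nonsquares
-- of 𝔽_q, this means that -2γ is a square of 𝔽_q.

open import Defs
open import Algebra.Bundles using (CommutativeMonoid; CommutativeRing; CommutativeSemiring)
open import Algebra.Morphism.Structures using (module RingMorphisms)
import Algebra.Properties.CommutativeMonoid.Sum as SumProperties
import Algebra.Properties.CommutativeSemiring.Binomial as Binomial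
import Algebra.Properties.CommutativeSemiring.Exp as ExpProperties
import Algebra.Properties.Ring as RingProperties
import Algebra.Properties.Semiring.Exp as SemiringExp
import Algebra.Properties.Semiring.Mult as MultProperties
import Algebra.Properties.Semiring.Mult.TCOptimised as MultTCOptimised
import Algebra.Solver.Ring as RingSolver
open import Algebra.Solver.Ring.AlmostCommutativeRing
  using (_-Raw-AlmostCommutative⟶_; fromCommutativeRing)
open import Data.Empty using (⊥-elim)
open import Data.Fin.Base as Fin
  using (Fin; zero; suc; fromℕ; inject₁; inject≤; punchIn; punchOut; combine; remQuot)
import Data.Fin.Permutation as Perm
import Data.Fin.Properties as Fin
open import Data.Integer.Base as ℤ using (ℤ; +_; -[1+_]; _⊖_)
import Data.Integer.Properties as ℤ
import Data.Maybe.Base as Maybe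
open import Data.Nat.Base as ℕ using (ℕ; zero; suc; _!; z≤n; s≤s)
open import Data.Nat.Combinatorics using (_C_; nCk≡n!/k![n-k]!; k![n∸k]!∣n!; nCn≡1)
open import Data.Nat.Divisibility as ℕ using (divides; _∤_)
open import Data.Nat.DivMod using (m/n*n≡m)
open import Data.Nat.Primality using (Prime; euclidsLemma; prime[2]; prime⇒nonTrivial)
import Data.Nat.Properties as ℕ
open import Data.Product.Base using (_×_; _,_; ∃-syntax; proj₁; proj₂)
open import Data.Sign.Base as Sign using (Sign)
open import Data.Sum.Base using (_⊎_; inj₁; inj₂; fromInj₁; map₁)
open import Data.Vec.Base using (Vec; []; _∷_; replicate)
open import Function.Base using (_∘_)
open import Function.Bundles using (_⇔_; mk⇔; Inverse)
open import Function.Definitions using (Injective)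
open import Level using (Level)
open import Relation.Binary.PropositionalEquality as ≡ using (_≡_; _≢_)
import Relation.Binary.Reasoning.Setoid as ≈-Reasoning
open import Relation.Nullary.Decidable using (Dec; yes; no; ¬?; map′; decidable-stable)
open import Relation.Nullary.Decidable.Core using (dec⇒maybe)
open import Relation.Nullary.Negation using (¬_; contradiction)

-- The collision for G ≠ 0 comes from looking for x in 𝔽_q: there x̄ = x, so f x = x for free, and f
-- (x + γ) = x follows from the linear equation G² (2x + γ + γ̄) = -1. Its solution does lie in 𝔽_q,
-- since Ḡ = -G makes G⁻² invariant under conjugation. For γ in 𝔽_q, two points with the same D
-- differ by some e in 𝔽_q, and their images differ by (1 + 2γD²) e. If -2γ = s², the factor is 1 -
-- (sD)², where sD again changes sign under conjugation and so is never 1 or -1. If -2γ is not a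
-- square, a D that kills the factor has to be produced: some δ ≠ 0 with δ̄ = -δ is needed, and the
-- fact that nonsquares of 𝔽_q differ by square factors. The latter is a counting argument, without
-- a generator of the multiplicative group. As 𝔽_q is given only as an abstract field with an
-- embedding, it must also be recognised inside the large field as the solution set of x ^ q = x.
-- Counting the roots of X ^ q - X does this and yields δ as well.

injective⇒surjective : ∀ {n} {g : Fin n → Fin n} → Injective _≡_ _≡_ g → ∀ j → ∃[ i ] g i ≡ j
injective⇒surjective {suc n} {g} g-injective j with Fin.any? (λ i → g i Fin.≟ j)
... | yes hit = hit
-- A missed value `j` can be deleted from the codomain, which leaves an injection into a smaller
-- set.
... | no miss = ⊥-elim (Fin.<⇒notInjective {f = λ i → punchOut (avoid i)} (ℕ.n<1+n n)
  (λ eq → g-injective (Fin.punchOut-injective (avoid _) (avoid _) eq)))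
  where
  avoid : ∀ i → j ≢ g i
  avoid i j≡gi = miss (i , ≡.sym j≡gi)

odd⇒1+k*2 : ∀ n → 2 ∤ n → ∃[ k ] n ≡ suc (k ℕ.* 2)
odd⇒1+k*2 zero 2∤0 = contradiction (2 ℕ.∣0) 2∤0
odd⇒1+k*2 (suc zero) _ = 0 , ≡.refl
odd⇒1+k*2 (suc (suc n)) 2∤2+n with k , eq ← odd⇒1+k*2 n (2∤2+n ∘ ℕ.∣m∣n⇒∣m+n ℕ.∣-refl) =
  suc k , ≡.cong (2 ℕ.+_) eq

-- Prime divisors of binomial coefficients and the Frobenius map

p∤k! : ∀ {p k} → Prime p → k ℕ.< p → p ∤ k !
p∤k! {k = zero} pr k<p p∣1 with ℕ.∣1⇒≡1 p∣1
... | ≡.refl = contradiction (prime⇒nonTrivial pr) λ ()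
p∤k! {k = suc k} pr k<p p∣ with euclidsLemma (suc k) (k !) pr p∣
... | inj₁ p∣1+k = ℕ.>⇒∤ k<p p∣1+k
... | inj₂ p∣k! = p∤k! pr (ℕ.<-trans (ℕ.n<1+n k) k<p) p∣k!

-- `p` divides p! = (p C k) · k! (p - k)!, but by `p∤k!` neither of the two factorials.
p∣pCk : ∀ {p k} → Prime p → 0 ℕ.< k → k ℕ.< p → p ℕ.∣ p C k
p∣pCk {p@(suc p-1)} {k@(suc k-1)} pr _ k<p
  with euclidsLemma (p C k) (k ! ℕ.* (p ℕ.∸ k) !) pr
         (≡.subst (p ℕ.∣_) (≡.sym eq) (ℕ.m∣m*n (p-1 !)))
  where
  instance _ = ℕ.m*n≢0 (k !) ((p ℕ.∸ k) !) {{k ℕ.!≢0}} {{(p ℕ.∸ k) ℕ.!≢0}}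
  eq : (p C k) ℕ.* (k ! ℕ.* (p ℕ.∸ k) !) ≡ p !
  eq = ≡.trans (≡.cong (ℕ._* (k ! ℕ.* (p ℕ.∸ k) !)) (nCk≡n!/k![n-k]! (ℕ.<⇒≤ k<p)))
         (m/n*n≡m (k![n∸k]!∣n! (ℕ.<⇒≤ k<p)))
... | inj₁ p∣C = p∣C
... | inj₂ p∣k![p-k]! with euclidsLemma (k !) ((p ℕ.∸ k) !) pr p∣k![p-k]!
...   | inj₁ p∣k! = contradiction p∣k! (p∤k! pr k<p)
...   | inj₂ p∣[p-k]! = contradiction p∣[p-k]! (p∤k! pr (s≤s (ℕ.m∸n≤m p-1 k-1)))

module _ {c ℓ} (M : CommutativeMonoid c ℓ) where
  open CommutativeMonoid M renaming (_∙_ to _+_; ε to 0#; ∙-cong to +-cong; ∙-congˡ to +-congˡ;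
    identityʳ to +-identityʳ)
  open SumProperties M using (sum; sum-remove; sum-cong-≋; sum-replicate-zero)

  -- Meant for the multiplicative monoid of a field, to evaluate a product of correction factors
  -- that are 1 except at one index.
  sum-supported : ∀ {n} (i : Fin n) (t : Fin n → Carrier) → (∀ j → i ≢ j → t j ≈ 0#) → sum t ≈ t i
  sum-supported {suc n} i t t≈0 = begin
    sum t                                ≈⟨ sum-remove {i = i} t ⟩
    t i + sum (λ j → t (punchIn i j))
      ≈⟨ +-congˡ (trans (sum-cong-≋ (λ j → t≈0 _ (λ eq → Fin.punchInᵢ≢i i j (≡.sym eq)))) (sum-replicate-zero n)) ⟩
    t i + 0#                             ≈⟨ +-identityʳ _ ⟩
    t i                                  ∎
    where open ≈-Reasoning setoid

module Frobenius {c ℓ} (S : CommutativeSemiring c ℓ) where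
  open CommutativeSemiring S hiding (zero)
  open SemiringExp semiring
  open MultProperties semiring renaming (_×_ to _·_)
  open SumProperties +-commutativeMonoid
  open Binomial S using (binomialTerm) renaming (theorem to binomial-theorem)
  open ≈-Reasoning setoid

  n·0≈0 : ∀ n → n · 0# ≈ 0#
  n·0≈0 zero = refl
  n·0≈0 (suc n) = trans (+-identityˡ _) (n·0≈0 n)

  multiple·≈0 : ∀ {p m} x → p · x ≈ 0# → p ℕ.∣ m → m · x ≈ 0#
  multiple·≈0 {p} x px≈0 (divides k ≡.refl) = begin
    (k ℕ.* p) · x  ≈⟨ ×-assocˡ x k p ⟨
    k · (p · x)    ≈⟨ ×-congʳ k px≈0 ⟩
    k · 0#         ≈⟨ n·0≈0 k ⟩
    0#             ∎

  n·x≈n·1*x : ∀ n x → n · x ≈ (n · 1#) * x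
  n·x≈n·1*x n x = sym (trans (×-assoc-* n 1# x) (×-congʳ n (*-identityˡ x)))

  ×1-homo-^ : ∀ m k → (m ℕ.^ k) · 1# ≈ (m · 1#) ^ k
  ×1-homo-^ m zero = +-identityʳ 1#
  ×1-homo-^ m (suc k) = trans (×1-homo-* m (m ℕ.^ k)) (*-congˡ (×1-homo-^ m k))

  -- All binomial coefficients except the two outer ones are multiples of `p` and vanish in
  -- characteristic `p`.
  frobenius : ∀ {p} → Prime p → p · 1# ≈ 0# → ∀ x y → (x + y) ^ p ≈ x ^ p + y ^ p
  frobenius {suc m} pr p·1≈0 x y = begin
    (x + y) ^ p                                       ≈⟨ binomial-theorem p x y ⟩
    t zero + sum (t ∘ suc)                            ≈⟨ +-congˡ (sum-init-last (t ∘ suc)) ⟩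
    t zero + (sum (t ∘ suc ∘ inject₁) + t (fromℕ p))  ≈⟨ +-cong first (+-cong middle last) ⟩
    y ^ p + (0# + x ^ p)                              ≈⟨ +-congˡ (+-identityˡ _) ⟩
    y ^ p + x ^ p                                     ≈⟨ +-comm _ _ ⟩
    x ^ p + y ^ p                                     ∎
    where
    p = suc m
    t = binomialTerm x y p

    first : t zero ≈ y ^ p
    first = trans (+-identityʳ _) (*-identityˡ _)

    t-middle : ∀ (i : Fin m) → t (suc (inject₁ i)) ≈ 0#
    t-middle i = multiple·≈0 _ (trans (n·x≈n·1*x p _) (trans (*-congʳ p·1≈0) (zeroˡ _)))
      (p∣pCk pr (s≤s z≤n) (s≤s (≡.subst (ℕ._< m) (≡.sym (Fin.toℕ-inject₁ i)) (Fin.toℕ<n i))))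

    middle : sum (t ∘ suc ∘ inject₁) ≈ 0#
    middle = trans (sum-cong-≋ t-middle) (sum-replicate-zero m)

    last : t (fromℕ p) ≈ x ^ p
    last rewrite Fin.toℕ-fromℕ m | nCn≡1 p | ℕ.n∸n≡0 m = trans (+-identityʳ _) (*-identityʳ _)

  frobenius^ : ∀ {p} → Prime p → p · 1# ≈ 0# → ∀ k x y → (x + y) ^ (p ℕ.^ k) ≈ x ^ (p ℕ.^ k) + y ^ (p ℕ.^ k)
  frobenius^ pr p·1≈0 zero x y =
    trans (*-identityʳ _) (+-cong (sym (*-identityʳ x)) (sym (*-identityʳ y)))
  frobenius^ {p} pr p·1≈0 (suc k) x y = begin
    (x + y) ^ (p ℕ.* p ℕ.^ k)                        ≈⟨ ^-assocʳ (x + y) p (p ℕ.^ k) ⟨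
    ((x + y) ^ p) ^ (p ℕ.^ k)                        ≈⟨ ^-congˡ (p ℕ.^ k) (frobenius pr p·1≈0 x y) ⟩
    (x ^ p + y ^ p) ^ (p ℕ.^ k)                      ≈⟨ frobenius^ pr p·1≈0 k _ _ ⟩
    (x ^ p) ^ (p ℕ.^ k) + (y ^ p) ^ (p ℕ.^ k)        ≈⟨ +-cong (^-assocʳ x p _) (^-assocʳ y p _) ⟩
    x ^ (p ℕ.* p ℕ.^ k) + y ^ (p ℕ.* p ℕ.^ k)        ∎

-- A ring solver with integer coefficients

module IntegerSolver {c ℓ} (R : CommutativeRing c ℓ) where
  open CommutativeRing R hiding (zero)
  open RingProperties ring
  open MultTCOptimised semiring renaming (_×_ to _·_)
  open ≈-Reasoning setoid

  -- With the optimised multiples `1 · 1#` reduces to `1#`, so `con (+ 1)` in a solver equation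
  -- denotes `1#` definitionally.
  ⟦_⟧ℤ : ℤ → Carrier
  ⟦ + n ⟧ℤ      = n · 1#
  ⟦ -[1+ n ] ⟧ℤ = - (suc n · 1#)

  cancel-+ : ∀ x y z → (x + y) - (x + z) ≈ y - z
  cancel-+ x y z = begin
    (x + y) + - (x + z)      ≈⟨ +-cong (+-comm x y) (-‿anti-homo-+ x z) ⟩
    (y + x) + (- z + - x)    ≈⟨ +-congˡ (+-comm _ _) ⟩
    (y + x) + (- x + - z)    ≈⟨ +-assoc y x _ ⟩
    y + (x + (- x + - z))    ≈⟨ +-congˡ (+-assoc x (- x) (- z)) ⟨
    y + ((x - x) + - z)      ≈⟨ +-congˡ (+-congʳ (-‿inverseʳ x)) ⟩
    y + (0# + - z)           ≈⟨ +-congˡ (+-identityˡ _) ⟩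
    y - z                    ∎

  ⊖-homo : ∀ m n → ⟦ m ⊖ n ⟧ℤ ≈ m · 1# - n · 1#
  ⊖-homo zero zero = sym (-‿inverseʳ 0#)
  ⊖-homo zero (suc n) = sym (+-identityˡ _)
  ⊖-homo (suc m) zero = sym (trans (+-congˡ -0#≈0#) (+-identityʳ _))
  ⊖-homo (suc m) (suc n) = begin
    ⟦ suc m ⊖ suc n ⟧ℤ                 ≡⟨ ≡.cong ⟦_⟧ℤ (ℤ.[1+m]⊖[1+n]≡m⊖n m n) ⟩
    ⟦ m ⊖ n ⟧ℤ                         ≈⟨ ⊖-homo m n ⟩
    m · 1# - n · 1#                    ≈⟨ cancel-+ 1# _ _ ⟨
    (1# + m · 1#) - (1# + n · 1#)      ≈⟨ +-cong (1+× m 1#) (-‿cong (1+× n 1#)) ⟨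
    suc m · 1# - suc n · 1#            ∎

  -homo : ∀ i → ⟦ ℤ.- i ⟧ℤ ≈ - ⟦ i ⟧ℤ
  -homo (+ zero) = sym -0#≈0#
  -homo (+ suc n) = refl
  -homo -[1+ n ] = sym (-‿involutive _)

  +homo : ∀ i j → ⟦ i ℤ.+ j ⟧ℤ ≈ ⟦ i ⟧ℤ + ⟦ j ⟧ℤ
  +homo (+ m) (+ n) = ×-homo-+ 1# m n
  +homo (+ m) -[1+ n ] = ⊖-homo m (suc n)
  +homo -[1+ m ] (+ n) = trans (⊖-homo n (suc m)) (+-comm _ _)
  +homo -[1+ m ] -[1+ n ] = begin
    - (suc (suc (m ℕ.+ n)) · 1#)        ≡⟨ ≡.cong (λ k → - (suc k · 1#)) (≡.sym (ℕ.+-suc m n)) ⟩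
    - ((suc m ℕ.+ suc n) · 1#)          ≈⟨ -‿cong (×-homo-+ 1# (suc m) (suc n)) ⟩
    - (suc m · 1# + suc n · 1#)         ≈⟨ -‿anti-homo-+ _ _ ⟩
    - (suc n · 1#) + - (suc m · 1#)     ≈⟨ +-comm _ _ ⟩
    - (suc m · 1#) + - (suc n · 1#)     ∎

  +◃-homo : ∀ n → ⟦ Sign.+ ℤ.◃ n ⟧ℤ ≈ n · 1#
  +◃-homo zero = refl
  +◃-homo (suc n) = refl

  -◃-homo : ∀ n → ⟦ Sign.- ℤ.◃ n ⟧ℤ ≈ - (n · 1#)
  -◃-homo zero = sym -0#≈0#
  -◃-homo (suc n) = refl

  *homo : ∀ i j → ⟦ i ℤ.* j ⟧ℤ ≈ ⟦ i ⟧ℤ * ⟦ j ⟧ℤ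
  *homo (+ m) (+ n) = trans (+◃-homo (m ℕ.* n)) (×1-homo-* m n)
  *homo (+ m) -[1+ n ] = trans (-◃-homo (m ℕ.* suc n))
    (trans (-‿cong (×1-homo-* m (suc n))) (-‿distribʳ-* _ _))
  *homo -[1+ m ] (+ n) = trans (-◃-homo (suc m ℕ.* n))
    (trans (-‿cong (×1-homo-* (suc m) n)) (-‿distribˡ-* _ _))
  *homo -[1+ m ] -[1+ n ] = begin
    (suc m ℕ.* suc n) · 1#               ≈⟨ ×1-homo-* (suc m) (suc n) ⟩
    suc m · 1# * suc n · 1#              ≈⟨ -‿involutive _ ⟨
    - - (suc m · 1# * suc n · 1#)        ≈⟨ -‿cong (-‿distribʳ-* _ _) ⟩
    - (suc m · 1# * - (suc n · 1#))      ≈⟨ -‿distribˡ-* _ _ ⟩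
    - (suc m · 1#) * - (suc n · 1#)      ∎

  morphism : ℤ.+-*-rawRing -Raw-AlmostCommutative⟶ fromCommutativeRing R
  morphism = record
    { ⟦_⟧ = ⟦_⟧ℤ ; +-homo = +homo ; *-homo = *homo ; -‿homo = -homo ; 0-homo = refl ; 1-homo = refl }

  open RingSolver ℤ.+-*-rawRing (fromCommutativeRing R) morphism
    (λ i j → Maybe.map (λ i≡j → reflexive (≡.cong ⟦_⟧ℤ i≡j)) (dec⇒maybe (i ℤ.≟ j)))
    public using (solve; _:=_; _:+_; _:*_; _:-_; :-_; _:^_; con)

-- Finite fields

module FiniteFieldProperties {c ℓ n} (F : FiniteField c ℓ n) where
  open FiniteField F hiding (zero)
  open RingProperties ring
  open SemiringExp semiring using (^-congˡ; ^-assocʳ)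
  open MultProperties semiring using (×1-homo-*)
  open Frobenius commutativeSemiring using (×1-homo-^)
  open IntegerSolver commutativeRing
  open ≈-Reasoning ≈-setoid
  private
    module Sum = SumProperties +-commutativeMonoid
    module Prod = SumProperties *-commutativeMonoid

  -- Enumeration and decidable equality

  index : Carrier → Fin n
  index = Inverse.to enumeration

  element : Fin n → Carrier
  element = Inverse.from enumeration

  index-cong : ∀ {x y} → x ≈ y → index x ≡ index y
  index-cong = Inverse.to-cong enumeration

  element-index : ∀ x → element (index x) ≈ x
  element-index = Inverse.strictlyInverseʳ enumeration

  index-element : ∀ i → index (element i) ≡ i
  index-element = Inverse.strictlyInverseˡ enumeration

  index-injective : ∀ {x y} → index x ≡ index y → x ≈ y
  index-injective {x} {y} eq = trans (sym (element-index x)) (trans (reflexive (≡.cong element eq)) (element-index y))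

  element-injective : ∀ {i j} → element i ≈ element j → i ≡ j
  element-injective {i} {j} eq = ≡.trans (≡.sym (index-element i)) (≡.trans (index-cong eq) (index-element j))

  infix 4 _≟_
  _≟_ : ∀ x y → Dec (x ≈ y)
  x ≟ y = map′ index-injective index-cong (index x Fin.≟ index y)

  -- Transported along the enumeration, `g` is an injective self-map of `Fin n`, and the pigeonhole
  -- principle applies.
  injective⇒bijective : ∀ {g : Carrier → Carrier} → (∀ {x y} → x ≈ y → g x ≈ g y) →
                        Injective _≈_ _≈_ g → IsPermutation g
  injective⇒bijective {g} g-cong g-injective = g-injective , λ y →
    let i , eq = injective⇒surjective {g = index ∘ g ∘ element}
                   (λ eq → element-injective (g-injective (index-injective eq))) (index y)
    in element i , λ z≈x → trans (g-cong z≈x) (index-injective eq)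

  -- Cancellation and zero divisors

  1≉0 : ¬ (1# ≈ 0#)
  1≉0 1≈0 = 0≉1 (sym 1≈0)

  x*y≈0⇒x≈0∨y≈0 : ∀ {x y} → x * y ≈ 0# → x ≈ 0# ⊎ y ≈ 0#
  x*y≈0⇒x≈0∨y≈0 {x} {y} xy≈0 with x ≟ 0#
  ... | yes x≈0 = inj₁ x≈0
  ... | no x≉0 with x⁻¹ , x⁻¹x≈1 , _ ← invertible x x≉0 = inj₂ (begin
    y                ≈⟨ *-identityˡ y ⟨
    1# * y           ≈⟨ *-congʳ x⁻¹x≈1 ⟨
    (x⁻¹ * x) * y    ≈⟨ *-assoc _ _ _ ⟩
    x⁻¹ * (x * y)    ≈⟨ *-congˡ xy≈0 ⟩
    x⁻¹ * 0#         ≈⟨ zeroʳ _ ⟩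
    0#               ∎)

  *-≉0 : ∀ {x y} → ¬ (x ≈ 0#) → ¬ (y ≈ 0#) → ¬ (x * y ≈ 0#)
  *-≉0 x≉0 y≉0 xy≈0 with x*y≈0⇒x≈0∨y≈0 xy≈0
  ... | inj₁ x≈0 = x≉0 x≈0
  ... | inj₂ y≈0 = y≉0 y≈0

  *-cancelˡ-≉0 : ∀ {x y z} → ¬ (x ≈ 0#) → x * y ≈ x * z → y ≈ z
  *-cancelˡ-≉0 {x} {y} {z} x≉0 eq with x*y≈0⇒x≈0∨y≈0 (trans (x[y-z]≈xy-xz x y z) (x≈y⇒x∙y⁻¹≈ε eq))
  ... | inj₁ x≈0 = contradiction x≈0 x≉0
  ... | inj₂ y-z≈0 = x∙y⁻¹≈ε⇒x≈y y z y-z≈0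

  x^n≈0⇒x≈0 : ∀ {x} m → x ^ m ≈ 0# → x ≈ 0#
  x^n≈0⇒x≈0 zero 1≈0 = contradiction 1≈0 1≉0
  x^n≈0⇒x≈0 (suc m) eq with x*y≈0⇒x≈0∨y≈0 eq
  ... | inj₁ x≈0 = x≈0
  ... | inj₂ x^m≈0 = x^n≈0⇒x≈0 m x^m≈0

  x²≈y²⇒x≈±y : ∀ {x y} → x ^ 2 ≈ y ^ 2 → x ≈ y ⊎ x ≈ - y
  x²≈y²⇒x≈±y {x} {y} eq with x*y≈0⇒x≈0∨y≈0 {x - y} {x - - y} (begin
      (x - y) * (x - - y)
        ≈⟨ solve 2 (λ x y → (x :- y) :* (x :- :- y) := x :^ 2 :- y :^ 2) refl x y ⟩
      x ^ 2 - y ^ 2                      ≈⟨ x≈y⇒x∙y⁻¹≈ε eq ⟩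
      0#                                 ∎)
  ... | inj₁ x-y≈0 = inj₁ (x∙y⁻¹≈ε⇒x≈y _ _ x-y≈0)
  ... | inj₂ x+y≈0 = inj₂ (x∙y⁻¹≈ε⇒x≈y _ _ x+y≈0)

  -- `0#` and `1#` have distinct indices. The shape `suc (suc m)` makes `0# ^ n` vanish and X ^ n -
  -- X monic of degree n.
  2≤n : ∃[ m ] n ≡ suc (suc m)
  2≤n = at-least-two n index 0≉1 index-injective
    where
    at-least-two : ∀ m (g : Carrier → Fin m) → ¬ (0# ≈ 1#) → (∀ {x y} → g x ≡ g y → x ≈ y) → ∃[ k ] m ≡ suc (suc k)
    at-least-two zero g _ _ with () ← g 0#
    at-least-two (suc zero) g 0≉1 inj = contradiction (inj (Fin1 (g 0#) (g 1#))) 0≉1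
      where
      Fin1 : (i j : Fin 1) → i ≡ j
      Fin1 zero zero = ≡.refl
    at-least-two (suc (suc m)) _ _ _ = m , ≡.refl

  -- Sums and products over all elements

  bijection⇒permutation : (g g⁻¹ : Carrier → Carrier) → (∀ {x y} → x ≈ y → g x ≈ g y) →
    (∀ {x y} → x ≈ y → g⁻¹ x ≈ g⁻¹ y) → (∀ x → g (g⁻¹ x) ≈ x) → (∀ x → g⁻¹ (g x) ≈ x) → Perm.Permutation n n
  bijection⇒permutation g g⁻¹ g-cong g⁻¹-cong gg⁻¹ g⁻¹g = Perm.permutation
    (index ∘ g ∘ element) (index ∘ g⁻¹ ∘ element)
    (λ i → ≡.trans (index-cong (trans (g-cong (element-index _)) (gg⁻¹ _))) (index-element i))
    (λ i → ≡.trans (index-cong (trans (g⁻¹-cong (element-index _)) (g⁻¹g _))) (index-element i))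

  -- Translation by 1 permutes the field, so the sum of all elements absorbs n · 1.
  n·1≈0 : n · 1# ≈ 0#
  n·1≈0 = +-identityʳ-unique (Sum.sum element) (n · 1#) (begin
    Sum.sum element + n · 1#                     ≈⟨ +-comm _ _ ⟩
    n · 1# + Sum.sum element                     ≈⟨ +-congʳ (Sum.sum-replicate n) ⟨
    Sum.sum {n} (λ _ → 1#) + Sum.sum element       ≈⟨ Sum.∑-distrib-+ (λ _ → 1#) element ⟨
    Sum.sum (λ i → 1# + element i)               ≈⟨ Sum.sum-cong-≋ (λ i → sym (element-index (1# + element i))) ⟩
    Sum.sum (λ i → element (π Perm.⟨$⟩ʳ i))      ≈⟨ Sum.sum-permute element π ⟨
    Sum.sum element                              ∎)
    where
    π = bijection⇒permutation (λ x → 1# + x) (λ x → - 1# + x) +-congˡ +-congˡ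
      (λ x → trans (sym (+-assoc _ _ _)) (trans (+-congʳ (-‿inverseʳ 1#)) (+-identityˡ x)))
      (λ x → trans (sym (+-assoc _ _ _)) (trans (+-congʳ (-‿inverseˡ 1#)) (+-identityˡ x)))

  -- `n · 1#` is the `k`-th power of `p · 1#`, and a field has no nilpotent elements besides 0.
  characteristic : ∀ {p k} → n ≡ p ℕ.^ k → p · 1# ≈ 0#
  characteristic {p} {k} ≡.refl = x^n≈0⇒x≈0 k (trans (sym (×1-homo-^ p k)) n·1≈0)

  0^n≈0 : ∀ {m} → ∃[ k ] m ≡ suc (suc k) → 0# ^ m ≈ 0#
  0^n≈0 (k , ≡.refl) = zeroˡ _

  or-one : Carrier → Carrier
  or-one x with x ≟ 0#
  ... | yes _ = 1#
  ... | no _ = x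

  or-one≉0 : ∀ x → ¬ (or-one x ≈ 0#)
  or-one≉0 x with x ≟ 0#
  ... | yes _ = 1≉0
  ... | no x≉0 = x≉0

  product≉0 : ∀ {m} (t : Fin m → Carrier) → (∀ i → ¬ (t i ≈ 0#)) → ¬ (Prod.sum t ≈ 0#)
  product≉0 {zero} t t≉0 = 1≉0
  product≉0 {suc m} t t≉0 = *-≉0 (t≉0 zero) (product≉0 (t ∘ suc) (t≉0 ∘ suc))

  -- Multiplication by a ≠ 0 permutes the nonzero elements. Replacing 0 by 1 in
  -- their product makes it a product over the whole field, at the cost of the
  -- correction factor a at 0.
  x^n≈x : ∀ x → x ^ n ≈ x
  x^n≈x a with a ≟ 0#
  ... | yes a≈0 = trans (^-congˡ n a≈0) (trans (0^n≈0 2≤n) (sym a≈0))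
  ... | no a≉0 with a⁻¹ , a⁻¹a≈1 , aa⁻¹≈1 ← invertible a a≉0 =
    *-cancelˡ-≉0 (product≉0 g (or-one≉0 ∘ element)) (begin
      Prod.sum g * a ^ n                                    ≈⟨ *-comm _ _ ⟩
      a ^ n * Prod.sum g                                    ≈⟨ *-congʳ (Prod.sum-replicate n) ⟨
      Prod.sum {n} (λ _ → a) * Prod.sum g                      ≈⟨ Prod.∑-distrib-+ (λ _ → a) g ⟨
      Prod.sum (λ i → a * g i)                              ≈⟨ Prod.sum-cong-≋ pointwise ⟩
      Prod.sum (λ i → k i * g (π Perm.⟨$⟩ʳ i))              ≈⟨ Prod.∑-distrib-+ k _ ⟩
      Prod.sum k * Prod.sum (λ i → g (π Perm.⟨$⟩ʳ i))          ≈⟨ *-cong product-k (sym (Prod.sum-permute g π)) ⟩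
      a * Prod.sum g                                        ≈⟨ *-comm _ _ ⟩
      Prod.sum g * a                                        ∎)
    where
    π = bijection⇒permutation (a *_) (a⁻¹ *_) *-congˡ *-congˡ
      (λ x → trans (sym (*-assoc _ _ _)) (trans (*-congʳ aa⁻¹≈1) (*-identityˡ x)))
      (λ x → trans (sym (*-assoc _ _ _)) (trans (*-congʳ a⁻¹a≈1) (*-identityˡ x)))

    g : Fin n → Carrier
    g = or-one ∘ element

    k : Fin n → Carrier
    k i with element i ≟ 0#
    ... | yes _ = a
    ... | no _ = 1#

    pointwise : ∀ i → a * g i ≈ k i * g (π Perm.⟨$⟩ʳ i)
    pointwise i with element i ≟ 0# | element (π Perm.⟨$⟩ʳ i) ≟ 0#
    ... | yes _   | yes _ = refl
    ... | yes x≈0 | no ax≉0 = contradiction (trans (element-index _) (trans (*-congˡ x≈0) (zeroʳ a))) ax≉0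
    ... | no x≉0  | yes ax≈0 = contradiction (trans (sym (element-index _)) ax≈0) (*-≉0 a≉0 x≉0)
    ... | no _    | no _ = trans (sym (element-index _)) (sym (*-identityˡ _))

    k-at-0 : k (index 0#) ≈ a
    k-at-0 with element (index 0#) ≟ 0#
    ... | yes _ = refl
    ... | no 0≉0 = contradiction (element-index 0#) 0≉0

    k-off-0 : ∀ i → index 0# ≢ i → k i ≈ 1#
    k-off-0 i i≢0 with element i ≟ 0#
    ... | yes x≈0 = contradiction (≡.trans (index-cong (sym x≈0)) (index-element i)) i≢0
    ... | no _ = refl

    product-k : Prod.sum k ≈ a
    product-k = trans (sum-supported *-commutativeMonoid (index 0#) k k-off-0) k-at-0

  -- If 2 vanished, then `n · 1#` would be 1 for `n` = 1 + 2k, whereas it is 0.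
  1+1≉0 : 2 ∤ n → ¬ (1# + 1# ≈ 0#)
  1+1≉0 2∤n 1+1≈0 with k , n≡1+2k ← odd⇒1+k*2 n 2∤n = 1≉0 (begin
    1#                          ≈⟨ +-identityʳ 1# ⟨
    1# + 0#                     ≈⟨ +-congˡ (zeroʳ (k · 1#)) ⟨
    1# + (k · 1#) * 0#          ≈⟨ +-congˡ (*-congˡ (trans (+-congˡ (+-identityʳ 1#)) 1+1≈0)) ⟨
    1# + (k · 1#) * (2 · 1#)    ≈⟨ +-congˡ (×1-homo-* k 2) ⟨
    suc (k ℕ.* 2) · 1#          ≡⟨ ≡.cong (_· 1#) n≡1+2k ⟨
    n · 1#                      ≈⟨ n·1≈0 ⟩
    0#                          ∎)

  -- Roots of polynomials

  -- A vector a₀ ∷ … ∷ aₘ₋₁ encodes the monic polynomial a₀ + a₁X + … + Xᵐ.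
  evaluate : ∀ {m} → Vec Carrier m → Carrier → Carrier
  evaluate [] x = 1#
  evaluate (a ∷ as) x = a + x * evaluate as x

  -- Synthetic division by X - c: the coefficients are the Horner values at `c` of the successive
  -- tails. The leading 1 stays implicit.
  quotient : ∀ {m} → Vec Carrier (suc m) → Carrier → Vec Carrier m
  quotient (a ∷ []) c = []
  quotient (a ∷ as@(_ ∷ _)) c = evaluate as c ∷ quotient as c

  quotient-correct : ∀ {m} (as : Vec Carrier (suc m)) c x →
    evaluate as x - evaluate as c ≈ (x - c) * evaluate (quotient as c) x
  quotient-correct (a ∷ []) c x =
    solve 4 (λ a c x o → (a :+ x :* o) :- (a :+ c :* o) := (x :- c) :* o) refl a c x 1#
  quotient-correct (a ∷ as@(_ ∷ _)) c x = begin
    (a + x * px) - (a + c * pc)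
      ≈⟨ solve 5 (λ a c x px pc → (a :+ x :* px) :- (a :+ c :* pc)
           := (x :- c) :* pc :+ x :* (px :- pc)) refl a c x px pc ⟩
    (x - c) * pc + x * (px - pc)
      ≈⟨ +-congˡ (*-congˡ (quotient-correct as c x)) ⟩
    (x - c) * pc + x * ((x - c) * qx)
      ≈⟨ solve 4 (λ c x pc qx → (x :- c) :* pc :+ x :* ((x :- c) :* qx)
           := (x :- c) :* (pc :+ x :* qx)) refl c x pc qx ⟩
    (x - c) * (pc + x * qx) ∎
    where
    px = evaluate as x
    pc = evaluate as c
    qx = evaluate (quotient as c) x

  -- Dividing by X - r for one root r keeps all the other roots and lowers the degree; the monic
  -- polynomial of degree 0 is the constant 1, which has no root.
  too-many-roots : ∀ {m} (as : Vec Carrier m) (root : Fin (suc m) → Carrier) →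
    (∀ {i j} → root i ≈ root j → i ≡ j) → ¬ (∀ i → evaluate as (root i) ≈ 0#)
  too-many-roots [] root _ vanishes = 1≉0 (vanishes zero)
  too-many-roots as@(_ ∷ _) root root-injective vanishes =
    too-many-roots (quotient as r) (root ∘ suc) (Fin.suc-injective ∘ root-injective) vanishes′
    where
    r = root zero
    vanishes′ : ∀ i → evaluate (quotient as r) (root (suc i)) ≈ 0#
    vanishes′ i with x*y≈0⇒x≈0∨y≈0 (trans (sym (quotient-correct as r (root (suc i))))
      (x≈y⇒x∙y⁻¹≈ε (trans (vanishes (suc i)) (sym (vanishes zero)))))
    ... | inj₁ x-r≈0 with () ← root-injective (x∙y⁻¹≈ε⇒x≈y _ _ x-r≈0)
    ... | inj₂ qx≈0 = qx≈0

  evaluate-replicate-0 : ∀ m x → evaluate (replicate m 0#) x ≈ x ^ m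
  evaluate-replicate-0 zero x = refl
  evaluate-replicate-0 (suc m) x = trans (+-identityˡ _) (*-congˡ (evaluate-replicate-0 m x))

  -- The vector used encodes X ^ m - X, which is monic of degree `m` because `m` is at least 2.
  power-fixed-points : ∀ {m} → ∃[ k ] m ≡ suc (suc k) → (root : Fin (suc m) → Carrier) →
    (∀ {i j} → root i ≈ root j → i ≡ j) → ¬ (∀ i → root i ^ m ≈ root i)
  power-fixed-points (k , ≡.refl) root root-injective fixed =
    too-many-roots (0# ∷ - 1# ∷ replicate k 0#) root root-injective λ i → let x = root i in begin
      0# + x * (- 1# + x * evaluate (replicate k 0#) x)
        ≈⟨ +-congˡ (*-congˡ (+-congˡ (*-congˡ (evaluate-replicate-0 k x)))) ⟩
      0# + x * (- 1# + x * x ^ k)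
        ≈⟨ solve 2 (λ x y → con (+ 0) :+ x :* (:- con (+ 1) :+ y) := x :* y :- x) refl x _ ⟩
      x * (x * x ^ k) - x
        ≈⟨ x≈y⇒x∙y⁻¹≈ε (fixed i) ⟩
      0# ∎

  -- Squares in odd characteristic

  module OddOrder (2∤n : 2 ∤ n) where
    x≈-x⇒x≈0 : ∀ {x} → x ≈ - x → x ≈ 0#
    x≈-x⇒x≈0 {x} x≈-x with x*y≈0⇒x≈0∨y≈0 {1# + 1#} {x} (begin
        (1# + 1#) * x     ≈⟨ solve 1 (λ x → (con (+ 1) :+ con (+ 1)) :* x := x :- :- x) refl x ⟩
        x - - x           ≈⟨ x≈y⇒x∙y⁻¹≈ε x≈-x ⟩
        0#                ∎)
    ... | inj₁ 2≈0 = contradiction 2≈0 (1+1≉0 2∤n)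
    ... | inj₂ x≈0 = x≈0

    -- A choice of sign: exactly one of x and -x is given the sign 0, for x ≠ 0.
    sgn : Carrier → Fin 2
    sgn x with index x Fin.<? index (- x)
    ... | yes _ = zero
    ... | no _ = suc zero

    -- Equal signs would compare the indices of `x` and `- x` in the same way in both orders. This
    -- forces the indices to be equal, hence `x` to be 0.
    sgn-neg : ∀ {x y} → ¬ (x ≈ 0#) → x ≈ - y → sgn x ≢ sgn y
    sgn-neg {x} {y} x≉0 x≈-y eq with index x Fin.<? index (- x) | index y Fin.<? index (- y)
    ... | yes i<j | yes k<l = ℕ.<-asym i<j (≡.subst₂ Fin._<_
      (index-cong (trans (sym (-‿involutive y)) (-‿cong (sym x≈-y)))) (index-cong (sym x≈-y)) k<l)
    ... | no i≮j | no k≮l = x≉0 (x≈-x⇒x≈0 (index-injective (Fin.toℕ-injective (ℕ.≤-antisym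
      (ℕ.≮⇒≥ (k≮l ∘ ≡.subst₂ Fin._<_ (index-cong -x≈y) (index-cong x≈-y))) (ℕ.≮⇒≥ i≮j)))))
      where -x≈y = trans (-‿cong x≈-y) (-‿involutive y)
    ... | yes _ | no _ with () ← eq
    ... | no _ | yes _ with () ← eq

    nonsquare-ratio : ∀ {d x y} → ¬ (y ≈ 0#) → x ^ 2 ≈ d * y ^ 2 → IsSquare d
    nonsquare-ratio {d} {x} {y} y≉0 x²≈dy² with z , zy≈1 , _ ← invertible y y≉0 = x * z , (begin
      d                          ≈⟨ solve 1 (λ d → d := d :* (con (+ 1) :* con (+ 1))) refl d ⟩
      d * (1# * 1#)              ≈⟨ *-congˡ (*-cong zy≈1 zy≈1) ⟨
      d * ((z * y) * (z * y))
        ≈⟨ solve 3 (λ d z y → d :* ((z :* y) :* (z :* y)) := (d :* y :^ 2) :* (z :* z)) refl d z y ⟩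
      (d * y ^ 2) * (z * z)      ≈⟨ *-congʳ x²≈dy² ⟨
      x ^ 2 * (z * z)            ≈⟨ solve 2 (λ x z → x :^ 2 :* (z :* z) := (x :* z) :^ 2) refl x z ⟩
      (x * z) ^ 2                ∎)

    -- For a nonsquare d, the map (i , x) ↦ (sgn x , dⁱ x²), with (i , 0) ↦ (i , 0),
    -- is an injective self-map of {0 , 1} × F, hence surjective.
    square∨nonsquare*square : ∀ {d} → ¬ IsSquare d → ∀ b → IsSquare b ⊎ (∃[ s ] b ≈ d * s ^ 2)
    square∨nonsquare*square {d} d-nonsquare b =
      -- The first component `zero` of the target is arbitrary; what matters is which `i` occurs in
      -- the preimage, as it tells whether `b` is 1 or `d` times a square.
      let k , eq = injective⇒surjective g-injective (encode (zero , b))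
      in from-preimage _ _ (proj₂ (encode-injective (Φ (decode k)) (zero , b) eq))
      where
      scale : Fin 2 → Carrier
      scale zero = 1#
      scale (suc zero) = d

      scale≉0 : ∀ i → ¬ (scale i ≈ 0#)
      scale≉0 zero = 1≉0
      scale≉0 (suc zero) d≈0 = d-nonsquare (0# , trans d≈0 (sym (zeroˡ _)))

      Φ : Fin 2 × Carrier → Fin 2 × Carrier
      Φ (i , x) with x ≟ 0#
      ... | yes _ = i , 0#
      ... | no _ = sgn x , scale i * x ^ 2

      scaled-square≉0 : ∀ i {x} → ¬ (x ≈ 0#) → ¬ (scale i * x ^ 2 ≈ 0#)
      scaled-square≉0 i x≉0 = *-≉0 (scale≉0 i) (x≉0 ∘ x^n≈0⇒x≈0 2)

      scale-determined : ∀ i j {x y} → ¬ (x ≈ 0#) → ¬ (y ≈ 0#) → scale i * x ^ 2 ≈ scale j * y ^ 2 → i ≡ j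
      scale-determined zero zero _ _ _ = ≡.refl
      scale-determined (suc zero) (suc zero) _ _ _ = ≡.refl
      scale-determined zero (suc zero) _ y≉0 eq =
        contradiction (nonsquare-ratio y≉0 (trans (sym (*-identityˡ _)) eq)) d-nonsquare
      scale-determined (suc zero) zero x≉0 _ eq =
        contradiction (nonsquare-ratio x≉0 (trans (sym (*-identityˡ _)) (sym eq))) d-nonsquare

      -- Away from 0 the second component determines `i`, because `d` is not a ratio of squares, and
      -- then `x` up to sign; the first component settles the sign. At 0 both scalings agree and
      -- there is no sign, so the first component is free to store `i`.
      Φ-injective : ∀ i x j y → proj₁ (Φ (i , x)) ≡ proj₁ (Φ (j , y)) → proj₂ (Φ (i , x)) ≈ proj₂ (Φ (j , y)) →
                    i ≡ j × x ≈ y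
      Φ-injective i x j y eq₁ eq₂ with x ≟ 0# | y ≟ 0#
      ... | yes x≈0 | yes y≈0 = eq₁ , trans x≈0 (sym y≈0)
      ... | yes _   | no y≉0  = contradiction (sym eq₂) (scaled-square≉0 j y≉0)
      ... | no x≉0  | yes _   = contradiction eq₂ (scaled-square≉0 i x≉0)
      ... | no x≉0  | no y≉0  with ≡.refl ← scale-determined i j x≉0 y≉0 eq₂
                              with x²≈y²⇒x≈±y (*-cancelˡ-≉0 (scale≉0 i) eq₂)
      ...   | inj₁ x≈y = ≡.refl , x≈y
      ...   | inj₂ x≈-y = contradiction eq₁ (sgn-neg x≉0 x≈-y)

      encode : Fin 2 × Carrier → Fin (2 ℕ.* n)
      encode (i , x) = combine i (index x)

      encode-injective : ∀ p q → encode p ≡ encode q → proj₁ p ≡ proj₁ q × proj₂ p ≈ proj₂ q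
      encode-injective (i , x) (j , y) eq =
        let i≡j , eq′ = Fin.combine-injective i (index x) j (index y) eq in i≡j , index-injective eq′

      decode : Fin (2 ℕ.* n) → Fin 2 × Carrier
      decode k = let i , j = remQuot {2} n k in i , element j

      decode-injective : ∀ k l → proj₁ (decode k) ≡ proj₁ (decode l) → proj₂ (decode k) ≈ proj₂ (decode l) → k ≡ l
      decode-injective k l eq₁ eq₂ = ≡.trans (≡.sym (Fin.combine-remQuot {2} n k))
        (≡.trans (≡.cong₂ combine eq₁ (element-injective eq₂)) (Fin.combine-remQuot {2} n l))

      g : Fin (2 ℕ.* n) → Fin (2 ℕ.* n)
      g k = encode (Φ (decode k))

      g-injective : Injective _≡_ _≡_ g
      g-injective {k} {l} eq =
        let eq₁ , eq₂ = encode-injective (Φ (decode k)) (Φ (decode l)) eq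
            eq₃ , eq₄ = Φ-injective _ _ _ _ eq₁ eq₂
        in decode-injective k l eq₃ eq₄

      from-preimage : ∀ i x → proj₂ (Φ (i , x)) ≈ b → IsSquare b ⊎ (∃[ s ] b ≈ d * s ^ 2)
      from-preimage i x eq with x ≟ 0#
      from-preimage i x eq          | yes _ = inj₁ (0# , trans (sym eq) (sym (zeroˡ _)))
      from-preimage zero x eq       | no _ = inj₁ (x , trans (sym eq) (*-identityˡ _))
      from-preimage (suc zero) x eq | no _ = inj₂ (x , sym eq)

-- Conjugation in the quadratic extension

module QuadraticExtension {c₁ ℓ₁ c₂ ℓ₂} (q : ℕ) (q-odd : IsOddPrimePower q)
  (K : FiniteField c₁ ℓ₁ q) (L : FiniteField c₂ ℓ₂ (q ℕ.^ 2))
  (ι : FiniteField.Carrier K → FiniteField.Carrier L) (ι-embedding : IsEmbedding K L ι) where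

  private
    module K where
      open FiniteField K public
      open FiniteFieldProperties K public
    module ι = RingMorphisms.IsRingHomomorphism ι-embedding
  open FiniteField L hiding (zero)
  open FiniteFieldProperties L
  open RingProperties ring
  open SemiringExp semiring using (^-congˡ; ^-assocʳ; ^-homo-*)
  open ExpProperties commutativeSemiring using (^-distrib-*)
  open Frobenius commutativeSemiring using (frobenius^)
  open IntegerSolver commutativeRing
  open ≈-Reasoning ≈-setoid

  2∤q : 2 ∤ q
  2∤q = proj₂ q-odd

  2∤q² : 2 ∤ q ℕ.^ 2
  2∤q² 2∣q² with euclidsLemma q (q ℕ.* 1) prime[2] 2∣q²
  ... | inj₁ 2∣q = 2∤q 2∣q
  ... | inj₂ 2∣q*1 = 2∤q (≡.subst (2 ℕ.∣_) (ℕ.*-identityʳ q) 2∣q*1)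

  open OddOrder 2∤q²
  module KOdd = K.OddOrder 2∤q

  conj : Carrier → Carrier
  conj x = x ^ q

  conj-cong : ∀ {x y} → x ≈ y → conj x ≈ conj y
  conj-cong = ^-congˡ q

  -- For `q` = `p ^ k` the large field has `p ^ (k * 2)` elements, hence characteristic `p`, and
  -- conjugation is an iterated Frobenius map.
  conj-+ : ∀ x y → conj (x + y) ≈ conj x + conj y
  conj-+ with p , k , pr , _ , ≡.refl ← proj₁ q-odd =
    frobenius^ pr (characteristic {p} {k ℕ.* 2} (ℕ.^-*-assoc p k 2)) k

  conj-* : ∀ x y → conj (x * y) ≈ conj x * conj y
  conj-* x y = ^-distrib-* x y q

  conj-0 : conj 0# ≈ 0#
  conj-0 = 0^n≈0 K.2≤n

  conj-1 : conj 1# ≈ 1#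
  conj-1 = 1^m≈1 q
    where
    1^m≈1 : ∀ m → 1# ^ m ≈ 1#
    1^m≈1 zero = refl
    1^m≈1 (suc m) = trans (*-identityˡ _) (1^m≈1 m)

  conj-neg : ∀ x → conj (- x) ≈ - conj x
  conj-neg x = +-inverseˡ-unique _ _ (trans (sym (conj-+ (- x) x)) (trans (conj-cong (-‿inverseˡ x)) conj-0))

  conj-sub : ∀ x y → conj (x - y) ≈ conj x - conj y
  conj-sub x y = trans (conj-+ x (- y)) (+-congˡ (conj-neg y))

  conj-^ : ∀ x m → conj (x ^ m) ≈ conj x ^ m
  conj-^ x zero = conj-1
  conj-^ x (suc m) = trans (conj-* x (x ^ m)) (*-congˡ (conj-^ x m))

  conj-conj : ∀ x → conj (conj x) ≈ x
  conj-conj x = begin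
    (x ^ q) ^ q          ≈⟨ ^-assocʳ x q q ⟩
    x ^ (q ℕ.* q)        ≡⟨ ≡.cong (λ m → x ^ (q ℕ.* m)) (≡.sym (ℕ.*-identityʳ q)) ⟩
    x ^ (q ℕ.^ 2)        ≈⟨ x^n≈x x ⟩
    x                    ∎

  -- The small field as the fixed field of conjugation

  ι-^ : ∀ a m → ι (a K.^ m) ≈ ι a ^ m
  ι-^ a zero = ι.1#-homo
  ι-^ a (suc m) = trans (ι.*-homo a (a K.^ m)) (*-congˡ (ι-^ a m))

  conj-ι : ∀ a → conj (ι a) ≈ ι a
  conj-ι a = trans (sym (ι-^ a q)) (ι.⟦⟧-cong (K.x^n≈x a))

  ι≉0 : ∀ {a} → ¬ (a K.≈ K.0#) → ¬ (ι a ≈ 0#)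
  ι≉0 {a} a≉0 ιa≈0 with a⁻¹ , a⁻¹a≈1 , _ ← K.invertible a a≉0 = 1≉0 (begin
    1#                ≈⟨ ι.1#-homo ⟨
    ι K.1#            ≈⟨ ι.⟦⟧-cong a⁻¹a≈1 ⟨
    ι (a⁻¹ K.* a)     ≈⟨ ι.*-homo a⁻¹ a ⟩
    ι a⁻¹ * ι a       ≈⟨ *-congˡ ιa≈0 ⟩
    ι a⁻¹ * 0#        ≈⟨ zeroʳ _ ⟩
    0#                ∎)

  ι-injective : ∀ {a b} → ι a ≈ ι b → a K.≈ b
  ι-injective {a} {b} eq with a K.- b K.≟ K.0#
  ... | yes a-b≈0 = RingProperties.x∙y⁻¹≈ε⇒x≈y K.ring a b a-b≈0
  ... | no a-b≉0 = contradiction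
    (trans (ι.+-homo a (K.- b)) (trans (+-congˡ (ι.-‿homo b)) (x≈y⇒x∙y⁻¹≈ε eq))) (ι≉0 a-b≉0)

  ι[-2a] : ∀ a → ι (K.- (2 K.· a)) ≈ - (ι a + ι a)
  ι[-2a] a = trans (ι.-‿homo _) (-‿cong (trans (ι.+-homo _ _)
    (+-congˡ (trans (ι.+-homo _ _) (trans (+-congˡ ι.0#-homo) (+-identityʳ _))))))

  -- The `q` elements of the image already are roots of X ^ q - X; a fixed `x` outside the image
  -- would be one root too many.
  fixed⇒image : ∀ {x} → conj x ≈ x → ∃[ a ] ι a ≈ x
  fixed⇒image {x} x̄≈x with Fin.any? (λ i → ι (K.element i) ≟ x)
  ... | yes (i , eq) = K.element i , eq
  ... | no ∉image = contradiction fixed (power-fixed-points K.2≤n root root-injective)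
    where
    root : Fin (suc q) → Carrier
    root zero = x
    root (suc i) = ι (K.element i)

    root-injective : ∀ {i j} → root i ≈ root j → i ≡ j
    root-injective {zero} {zero} _ = ≡.refl
    root-injective {zero} {suc j} eq = contradiction (j , sym eq) ∉image
    root-injective {suc i} {zero} eq = contradiction (i , eq) ∉image
    root-injective {suc i} {suc j} eq = ≡.cong suc (K.element-injective (ι-injective eq))

    fixed : ∀ i → conj (root i) ≈ root i
    fixed zero = x̄≈x
    fixed (suc i) = conj-ι (K.element i)

  q<q² : q ℕ.< q ℕ.^ 2
  q<q² with m , ≡.refl ← K.2≤n =
    ≡.subst (λ k → q ℕ.< q ℕ.* k) (≡.sym (ℕ.*-identityʳ q)) (ℕ.m<m*n q q (s≤s (s≤s z≤n)))

  -- Conjugation moves some x, and x - x̄ is then nonzero and changes sign.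
  antifixed-element : ∃[ δ ] (¬ (δ ≈ 0#) × conj δ ≈ - δ)
  antifixed-element with Fin.any? (λ i → ¬? (conj (element i) ≟ element i))
  ... | yes (i , x̄≉x) = x - conj x , (λ δ≈0 → x̄≉x (sym (x∙y⁻¹≈ε⇒x≈y _ _ δ≈0))) , (begin
    conj (x - conj x)          ≈⟨ conj-sub x (conj x) ⟩
    conj x - conj (conj x)     ≈⟨ +-congˡ (-‿cong (conj-conj x)) ⟩
    conj x - x                 ≈⟨ ⁻¹-anti-homo‿- x (conj x) ⟨
    - (x - conj x)             ∎)
    where x = element i
  ... | no all-fixed = contradiction (λ i → decidable-stable (_ ≟ _) (λ x̄≉x → all-fixed (_ , x̄≉x)))
    -- If everything were fixed, the first `q` + 1 of the `q ^ 2` elements would already be too many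
    -- roots.
    (power-fixed-points K.2≤n (λ i → element (inject≤ i q<q²))
      (Fin.inject≤-injective q<q² q<q² _ _ ∘ element-injective))

  antifixed-square : ∀ {δ} → conj δ ≈ - δ → conj (δ ^ 2) ≈ δ ^ 2
  antifixed-square {δ} δ̄≈-δ = begin
    conj (δ ^ 2)     ≈⟨ conj-^ δ 2 ⟩
    conj δ ^ 2       ≈⟨ ^-congˡ 2 δ̄≈-δ ⟩
    (- δ) ^ 2        ≈⟨ solve 1 (λ δ → (:- δ) :^ 2 := δ :^ 2) refl δ ⟩
    δ ^ 2            ∎

  fixed∧antifixed⇒0 : ∀ {δ} → conj δ ≈ δ → conj δ ≈ - δ → δ ≈ 0#
  fixed∧antifixed⇒0 δ̄≈δ δ̄≈-δ = x≈-x⇒x≈0 (trans (sym δ̄≈δ) δ̄≈-δ)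

  -- A root of `d` in the small field would be `δ` or `- δ`, so `δ` would be both fixed and negated
  -- by conjugation.
  antifixed-square-nonsquare : ∀ {δ d} → ¬ (δ ≈ 0#) → conj δ ≈ - δ → ι d ≈ δ ^ 2 → ¬ K.IsSquare d
  antifixed-square-nonsquare {δ} {d} δ≉0 δ̄≈-δ ιd≈δ² (s , d≈s²)
    with x²≈y²⇒x≈±y (trans (sym ιd≈δ²) (trans (ι.⟦⟧-cong d≈s²) (ι-^ s 2)))
  ... | inj₁ δ≈ιs = δ≉0 (fixed∧antifixed⇒0 (trans (conj-cong δ≈ιs) (trans (conj-ι s) (sym δ≈ιs))) δ̄≈-δ)
  ... | inj₂ δ≈-ιs = δ≉0 (fixed∧antifixed⇒0 (trans (conj-cong δ≈-ιs)
    (trans (conj-neg (ι s)) (trans (-‿cong (conj-ι s)) (sym δ≈-ιs)))) δ̄≈-δ)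

  -- Otherwise `u` is 1 or -1, hence fixed as well as negated. This keeps the factor 1 - (sD)² away
  -- from 0.
  antifixed-square≉1 : ∀ {u} → conj u ≈ - u → ¬ (u ^ 2 ≈ 1#)
  antifixed-square≉1 {u} ū≈-u u²≈1 =
    1≉0 (trans (sym u²≈1) (trans (^-congˡ 2 (fixed∧antifixed⇒0 fixed ū≈-u)) (zeroˡ _)))
    where
    fixed : conj u ≈ u
    fixed with x²≈y²⇒x≈±y {u} {1#} (trans u²≈1 (sym (trans (*-identityˡ _) (*-identityˡ _))))
    ... | inj₁ u≈1 = trans (conj-cong u≈1) (trans conj-1 (sym u≈1))
    ... | inj₂ u≈-1 = trans (conj-cong u≈-1) (trans (conj-neg 1#) (trans (-‿cong conj-1) (sym u≈-1)))

  -- Inverses and division by two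

  inverse-unique : ∀ {x y z} → x * z ≈ 1# → y * z ≈ 1# → x ≈ y
  inverse-unique {x} {y} {z} xz≈1 yz≈1 = begin
    x                ≈⟨ *-identityʳ x ⟨
    x * 1#           ≈⟨ *-congˡ yz≈1 ⟨
    x * (y * z)      ≈⟨ solve 3 (λ x y z → x :* (y :* z) := y :* (x :* z)) refl x y z ⟩
    y * (x * z)      ≈⟨ *-congˡ xz≈1 ⟩
    y * 1#           ≈⟨ *-identityʳ y ⟩
    y                ∎

  conj-inverse : ∀ {x y} → x * y ≈ 1# → conj x * conj y ≈ 1#
  conj-inverse xy≈1 = trans (sym (conj-* _ _)) (trans (conj-cong xy≈1) conj-1)

  -- Conjugating the equation shows that `- conj x` is also an inverse of `y`.
  antifixed-inverse : ∀ {x y} → x * y ≈ 1# → conj y ≈ - y → conj x ≈ - x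
  antifixed-inverse {x} {y} xy≈1 ȳ≈-y = trans (sym (-‿involutive _)) (-‿cong (inverse-unique (begin
    - conj x * y     ≈⟨ solve 2 (λ x y → (:- x) :* y := x :* (:- y)) refl (conj x) y ⟩
    conj x * - y     ≈⟨ *-congˡ ȳ≈-y ⟨
    conj x * conj y  ≈⟨ conj-inverse xy≈1 ⟩
    1#               ∎) xy≈1))

  half : Carrier
  half = proj₁ (invertible (1# + 1#) (1+1≉0 2∤q²))

  half*2≈1 : half * (1# + 1#) ≈ 1#
  half*2≈1 = proj₁ (proj₂ (invertible (1# + 1#) (1+1≉0 2∤q²)))

  half≉0 : ¬ (half ≈ 0#)
  half≉0 half≈0 = 1≉0 (trans (sym half*2≈1) (trans (*-congʳ half≈0) (zeroˡ _)))

  conj-half : conj half ≈ half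
  conj-half = inverse-unique
    (trans (*-congˡ (sym (trans (conj-+ 1# 1#) (+-cong conj-1 conj-1)))) (conj-inverse half*2≈1)) half*2≈1

  -- The permutation criterion

  Tr-cubic : ∀ x → Tr q L (x ^ 3 - x ^ (q ℕ.+ 2)) ≈ (x - conj x) ^ 2 * (x + conj x)
  Tr-cubic x = begin
    w + conj w
      ≈⟨ +-cong w≈ (trans (conj-cong w≈) (trans (conj-sub _ _) (+-cong (conj-^ x 3)
           (-‿cong (trans (conj-* _ _) (*-cong (conj-conj x) (conj-^ x 2))))))) ⟩
    (x ^ 3 - conj x * x ^ 2) + (conj x ^ 3 - x * conj x ^ 2)
      ≈⟨ solve 2 (λ x y → (x :^ 3 :- y :* x :^ 2) :+ (y :^ 3 :- x :* y :^ 2)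
           := (x :- y) :^ 2 :* (x :+ y)) refl x (conj x) ⟩
    (x - conj x) ^ 2 * (x + conj x) ∎
    where
    w = x ^ 3 - x ^ (q ℕ.+ 2)
    w≈ : w ≈ x ^ 3 - conj x * x ^ 2
    w≈ = +-congˡ (-‿cong (^-homo-* x q 2))

  -- The conjugate is a parameter `y`, so that a value already computed for it can be substituted
  -- directly.
  f-at : ∀ γ x {y} → conj x ≈ y → f q L γ x ≈ x + γ * ((x - y) ^ 2 * (x + y))
  f-at γ x x̄≈y = +-congˡ (*-congˡ (trans (Tr-cubic x)
    (*-cong (^-congˡ 2 (+-congˡ (-‿cong x̄≈y))) (+-congˡ x̄≈y))))

  f-cong : ∀ γ {x y} → x ≈ y → f q L γ x ≈ f q L γ y
  f-cong γ x≈y = +-cong x≈y (*-congˡ (+-cong w (conj-cong w)))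
    where w = +-cong (^-congˡ 3 x≈y) (-‿cong (^-congˡ (q ℕ.+ 2) x≈y))

  -- If γ - γ̄ has an inverse H, then x = -(H² + γ + γ̄)/2 satisfies f (x + γ) = f x = x.
  difference-invertible⇒¬injective : ∀ γ H → H * (γ - conj γ) ≈ 1# → ¬ Injective _≈_ _≈_ (f q L γ)
  -- The collision forces `γ` to be 0, and then γ - γ̄ = 0 cannot be invertible.
  difference-invertible⇒¬injective γ H HG≈1 f-injective = 1≉0 (begin
    1#                       ≈⟨ HG≈1 ⟨
    H * (γ - conj γ)         ≈⟨ *-congˡ (+-cong γ≈0 (-‿cong (trans (conj-cong γ≈0) conj-0))) ⟩
    H * (0# - 0#)            ≈⟨ *-congˡ (-‿inverseʳ 0#) ⟩
    H * 0#                   ≈⟨ zeroʳ H ⟩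
    0#                       ∎)
    where
    γ̄ = conj γ
    x = - (half * (H ^ 2 + (γ + γ̄)))

    conj-H² : conj (H ^ 2) ≈ H ^ 2
    conj-H² = antifixed-square (antifixed-inverse HG≈1 (begin
      conj (γ - γ̄)     ≈⟨ conj-sub γ γ̄ ⟩
      γ̄ - conj γ̄       ≈⟨ +-congˡ (-‿cong (conj-conj γ)) ⟩
      γ̄ - γ            ≈⟨ ⁻¹-anti-homo‿- γ γ̄ ⟨
      - (γ - γ̄)        ∎))

    conj-x : conj x ≈ x
    conj-x = trans (conj-neg _) (-‿cong (trans (conj-* _ _) (*-cong conj-half
      (trans (conj-+ _ _) (+-cong conj-H² (trans (conj-+ _ _) (trans (+-congˡ (conj-conj γ)) (+-comm _ _))))))))

    fx≈x : f q L γ x ≈ x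
    fx≈x = trans (f-at γ x conj-x)
      (solve 2 (λ γ x → x :+ γ :* ((x :- x) :^ 2 :* (x :+ x)) := x) refl γ x)

    D²T≈-1 : ((x + γ) - (x + γ̄)) ^ 2 * ((x + γ) + (x + γ̄)) ≈ - 1#
    D²T≈-1 = begin
      ((x + γ) - (x + γ̄)) ^ 2 * ((x + γ) + (x + γ̄))
        -- The solver cannot use that `half` inverts 2, so the product of the two is isolated first
        -- and replaced afterwards.
        ≈⟨ solve 4 (λ h H γ γ̄ → let x = :- (h :* (H :^ 2 :+ (γ :+ γ̄))) in
             ((x :+ γ) :- (x :+ γ̄)) :^ 2 :* ((x :+ γ) :+ (x :+ γ̄))
             := (γ :- γ̄) :^ 2 :* ((γ :+ γ̄) :- (h :* (con (+ 1) :+ con (+ 1))) :* (H :^ 2 :+ (γ :+ γ̄))))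
             refl half H γ γ̄ ⟩
      (γ - γ̄) ^ 2 * ((γ + γ̄) - (half * (1# + 1#)) * (H ^ 2 + (γ + γ̄)))
        ≈⟨ *-congˡ (+-congˡ (-‿cong (*-congʳ half*2≈1))) ⟩
      (γ - γ̄) ^ 2 * ((γ + γ̄) - 1# * (H ^ 2 + (γ + γ̄)))
        -- The sum γ + γ̄ cancels, leaving -G²H².
        ≈⟨ solve 3 (λ H γ γ̄ → (γ :- γ̄) :^ 2 :* ((γ :+ γ̄) :- con (+ 1) :* (H :^ 2 :+ (γ :+ γ̄)))
             := :- ((H :* (γ :- γ̄)) :^ 2)) refl H γ γ̄ ⟩
      - ((H * (γ - γ̄)) ^ 2)
        ≈⟨ -‿cong (^-congˡ 2 HG≈1) ⟩
      - (1# ^ 2)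
        ≈⟨ -‿cong (trans (*-identityˡ _) (*-identityˡ _)) ⟩
      - 1# ∎

    f[x+γ]≈x : f q L γ (x + γ) ≈ x
    f[x+γ]≈x = begin
      f q L γ (x + γ)
        ≈⟨ f-at γ (x + γ) (trans (conj-+ x γ) (+-congʳ conj-x)) ⟩
      (x + γ) + γ * (((x + γ) - (x + γ̄)) ^ 2 * ((x + γ) + (x + γ̄)))
        ≈⟨ +-congˡ (*-congˡ D²T≈-1) ⟩
      (x + γ) + γ * - 1#
        ≈⟨ solve 2 (λ x γ → (x :+ γ) :+ γ :* (:- con (+ 1)) := x) refl x γ ⟩
      x ∎

    γ≈0 : γ ≈ 0#
    γ≈0 = +-identityʳ-unique x γ (f-injective (trans f[x+γ]≈x (sym fx≈x)))

  injective⇒γ-fixed : ∀ γ → Injective _≈_ _≈_ (f q L γ) → conj γ ≈ γ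
  injective⇒γ-fixed γ f-injective with conj γ ≟ γ
  ... | yes γ̄≈γ = γ̄≈γ
  ... | no γ̄≉γ with H , HG≈1 , _ ← invertible (γ - conj γ) (λ G≈0 → γ̄≉γ (sym (x∙y⁻¹≈ε⇒x≈y _ _ G≈0))) =
    ⊥-elim (difference-invertible⇒¬injective γ H HG≈1 f-injective)

  -- A root E of -2γ outside K makes f collide: for D = 1/E, the points (1 + D)/2 and D/2
  -- have the same image.
  antifixed-root⇒¬injective : ∀ γ D E → D * E ≈ 1# → conj E ≈ - E → - (γ + γ) ≈ E ^ 2 →
                              ¬ Injective _≈_ _≈_ (f q L γ)
  antifixed-root⇒¬injective γ D E DE≈1 Ē≈-E -2γ≈E² f-injective =
    half≉0 (+-identityʳ-unique y half (trans (+-comm y half) (f-injective (trans fx≈y (sym fy≈y)))))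
    where
    y = half * D

    conj-y : conj y ≈ - y
    conj-y = trans (conj-* half D)
      (trans (*-cong conj-half (antifixed-inverse DE≈1 Ē≈-E)) (sym (-‿distribʳ-* half D)))

    fy≈y : f q L γ y ≈ y
    fy≈y = trans (f-at γ y conj-y)
      (solve 2 (λ γ y → y :+ γ :* ((y :- :- y) :^ 2 :* (y :- y)) := y) refl γ y)

    -- Equivalently 1 + 2γD² = 0: the multiplier of the sum of conjugates vanishes on this D.
    γD²≈ : γ * D ^ 2 ≈ - half
    γD²≈ = begin
      γ * D ^ 2                              ≈⟨ *-identityˡ _ ⟨
      1# * (γ * D ^ 2)                       ≈⟨ *-congʳ half*2≈1 ⟨
      (half * (1# + 1#)) * (γ * D ^ 2)
        ≈⟨ solve 3 (λ h γ D → (h :* (con (+ 1) :+ con (+ 1))) :* (γ :* D :^ 2)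
             := :- (h :* (:- (γ :+ γ) :* D :^ 2)))
             refl half γ D ⟩
      - (half * (- (γ + γ) * D ^ 2))         ≈⟨ -‿cong (*-congˡ (*-congʳ -2γ≈E²)) ⟩
      - (half * (E ^ 2 * D ^ 2))
        ≈⟨ solve 3 (λ h E D → :- (h :* (E :^ 2 :* D :^ 2)) := :- (h :* (D :* E) :^ 2)) refl half E D ⟩
      - (half * (D * E) ^ 2)                 ≈⟨ -‿cong (*-congˡ (^-congˡ 2 DE≈1)) ⟩
      - (half * 1# ^ 2)
        ≈⟨ solve 1 (λ h → :- (h :* con (+ 1) :^ 2) := :- h) refl half ⟩
      - half                                 ∎

    fx≈y : f q L γ (half + y) ≈ y
    fx≈y = begin
      f q L γ (half + y)
        ≈⟨ f-at γ (half + y) (trans (conj-+ half y) (+-cong conj-half conj-y)) ⟩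
      (half + y) + γ * (((half + y) - (half - y)) ^ 2 * ((half + y) + (half - y)))
        -- The point `half + y` minus its conjugate is D, and plus its conjugate is 1; both appear
        -- with 2 · `half` still to be cancelled.
        ≈⟨ solve 3 (λ h γ D → let y = h :* D in
             (h :+ y) :+ γ :* (((h :+ y) :- (h :- y)) :^ 2 :* ((h :+ y) :+ (h :- y)))
             := (h :+ y) :+ γ :* (((h :* (con (+ 1) :+ con (+ 1))) :* D) :^ 2 :* (h :* (con (+ 1) :+ con (+ 1)))))
             refl half γ D ⟩
      (half + y) + γ * (((half * (1# + 1#)) * D) ^ 2 * (half * (1# + 1#)))
        ≈⟨ +-congˡ (*-congˡ (*-cong (^-congˡ 2 (*-congʳ half*2≈1)) half*2≈1)) ⟩
      (half + y) + γ * ((1# * D) ^ 2 * 1#)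
        ≈⟨ +-congˡ (*-congˡ (trans (*-identityʳ _) (^-congˡ 2 (*-identityˡ D)))) ⟩
      (half + y) + γ * D ^ 2
        ≈⟨ +-congˡ γD²≈ ⟩
      (half + y) - half
        ≈⟨ xyx⁻¹≈y half y ⟩
      y ∎

  -- For `s` ≠ 0 the element `δ * ι s` is a root of -2γ that conjugation negates, which contradicts
  -- injectivity; for `s` = 0 the value is 0, a square.
  antifixed-multiple-square : ∀ {γ a δ d s} → ι a ≈ γ → ¬ (δ ≈ 0#) → conj δ ≈ - δ → ι d ≈ δ ^ 2 →
    Injective _≈_ _≈_ (f q L γ) → K.- (2 K.· a) K.≈ d K.* s K.^ 2 → K.IsSquare (K.- (2 K.· a))
  antifixed-multiple-square {γ} {a} {δ} {d} {s} ιa≈γ δ≉0 δ̄≈-δ ιd≈δ² f-injective -2a≈ds² with s K.≟ K.0#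
  ... | yes s≈0 = K.0# , K.trans -2a≈ds²
    (K.trans (K.*-congˡ (K.trans (K.*-congʳ s≈0) (K.zeroˡ _))) (K.trans (K.zeroʳ d) (K.sym (K.zeroˡ _))))
  ... | no s≉0 =
    let D , DE≈1 , _ = invertible E (*-≉0 δ≉0 (ι≉0 s≉0))
    in ⊥-elim (antifixed-root⇒¬injective γ D E DE≈1 E-antifixed -2γ≈E² f-injective)
    where
    E = δ * ι s

    E-antifixed : conj E ≈ - E
    E-antifixed = trans (conj-* δ (ι s)) (trans (*-cong δ̄≈-δ (conj-ι s)) (sym (-‿distribˡ-* _ _)))

    -2γ≈E² : - (γ + γ) ≈ E ^ 2
    -2γ≈E² = begin
      - (γ + γ)               ≈⟨ -‿cong (+-cong ιa≈γ ιa≈γ) ⟨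
      - (ι a + ι a)           ≈⟨ ι[-2a] a ⟨
      ι (K.- (2 K.· a))       ≈⟨ ι.⟦⟧-cong -2a≈ds² ⟩
      ι (d K.* s K.^ 2)       ≈⟨ ι.*-homo _ _ ⟩
      ι d * ι (s K.^ 2)       ≈⟨ *-cong ιd≈δ² (ι-^ s 2) ⟩
      δ ^ 2 * ι s ^ 2         ≈⟨ ^-distrib-* δ (ι s) 2 ⟨
      E ^ 2                   ∎

  -- The square of `δ` comes from a nonsquare `d` of the small field, so -2a is either a square, as
  -- wanted, or `d` times a square.
  permutation⇒square : ∀ γ → IsPermutation (f q L γ) → ∃[ a ] (ι a ≈ γ × K.IsSquare (K.- (2 K.· a)))
  permutation⇒square γ (f-injective , _) =
    let a , ιa≈γ = fixed⇒image (injective⇒γ-fixed γ f-injective)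
        δ , δ≉0 , δ̄≈-δ = antifixed-element
        d , ιd≈δ² = fixed⇒image (antifixed-square δ̄≈-δ)
    in a , ιa≈γ , fromInj₁
         (λ (s , -2a≈ds²) → antifixed-multiple-square ιa≈γ δ≉0 δ̄≈-δ ιd≈δ² f-injective -2a≈ds²)
         (KOdd.square∨nonsquare*square (antifixed-square-nonsquare δ≉0 δ̄≈-δ ιd≈δ²) (K.- (2 K.· a)))

  -- Points with equal images share D, and their difference is annihilated by 1 + 2γD² = 1 - (sD)²,
  -- where sD is negated by conjugation.
  square⇒injective : ∀ γ s → conj γ ≈ γ → conj s ≈ s → - (γ + γ) ≈ s ^ 2 → Injective _≈_ _≈_ (f q L γ)
  square⇒injective γ s γ̄≈γ s̄≈s -2γ≈s² {x} {y} fx≈fy = x≈y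
    where
    x̄ = conj x
    ȳ = conj y

    F : Carrier → Carrier → Carrier
    F u v = u + γ * ((u - v) ^ 2 * (u + v))

    Fx≈Fy : F x x̄ ≈ F y ȳ
    Fx≈Fy = trans (sym (f-at γ x refl)) (trans fx≈fy (f-at γ y refl))

    conj-F : ∀ u → conj (F u (conj u)) ≈ F (conj u) u
    conj-F u = trans (conj-+ _ _) (+-congˡ (trans (conj-* _ _) (*-cong γ̄≈γ (trans (conj-* _ _)
      (*-cong (trans (conj-^ _ 2) (^-congˡ 2 (trans (conj-sub _ _) (+-congˡ (-‿cong (conj-conj u))))))
              (trans (conj-+ _ _) (+-congˡ (conj-conj u))))))))

    -- γ (u - v)² (u + v) is symmetric, so f preserves the difference of conjugates.
    difference : ∀ u v → u - v ≈ F u v - F v u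
    difference u v = solve 3 (λ γ u v → u :- v :=
      (u :+ γ :* ((u :- v) :^ 2 :* (u :+ v))) :- (v :+ γ :* ((v :- u) :^ 2 :* (v :+ u)))) refl γ u v

    D≈ : x - x̄ ≈ y - ȳ
    D≈ = begin
      x - x̄                  ≈⟨ difference x x̄ ⟩
      F x x̄ - F x̄ x          ≈⟨ +-cong Fx≈Fy (-‿cong (trans (sym (conj-F x)) (trans (conj-cong Fx≈Fy) (conj-F y)))) ⟩
      F y ȳ - F ȳ y          ≈⟨ difference y ȳ ⟨
      y - ȳ                  ∎

    D = x - x̄
    e = x - y

    x̄-ȳ≈e : x̄ - ȳ ≈ e
    x̄-ȳ≈e = begin
      x̄ - ȳ
        ≈⟨ solve 4 (λ x y x̄ ȳ → x̄ :- ȳ := (x :- y) :+ ((y :- ȳ) :- (x :- x̄))) refl x y x̄ ȳ ⟩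
      e + ((y - ȳ) - D)          ≈⟨ +-congˡ (x≈y⇒x∙y⁻¹≈ε (sym D≈)) ⟩
      e + 0#                     ≈⟨ +-identityʳ e ⟩
      e                          ∎

    -- This is the difference of the two images: since x̄ - ȳ = e as well, the sums of conjugates
    -- differ by 2e.
    factored : e * (1# - (s * D) ^ 2) ≈ 0#
    factored = begin
      e * (1# - (s * D) ^ 2)
        ≈⟨ solve 3 (λ e s D → e :* (con (+ 1) :- (s :* D) :^ 2)
             := e :* (con (+ 1) :- s :^ 2 :* D :^ 2)) refl e s D ⟩
      e * (1# - s ^ 2 * D ^ 2)
        ≈⟨ *-congˡ (+-congˡ (-‿cong (*-congʳ -2γ≈s²))) ⟨
      e * (1# - - (γ + γ) * D ^ 2)
        ≈⟨ solve 3 (λ e γ D → e :* (con (+ 1) :- :- (γ :+ γ) :* D :^ 2)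
             := e :+ γ :* (D :^ 2 :* (e :+ e))) refl e γ D ⟩
      e + γ * (D ^ 2 * (e + e))
        ≈⟨ +-congˡ (*-congˡ (*-congˡ (+-congˡ x̄-ȳ≈e))) ⟨
      e + γ * (D ^ 2 * (e + (x̄ - ȳ)))
        ≈⟨ solve 6 (λ x y x̄ ȳ γ D → (x :- y) :+ γ :* (D :^ 2 :* ((x :- y) :+ (x̄ :- ȳ)))
             := (x :+ γ :* (D :^ 2 :* (x :+ x̄))) :- (y :+ γ :* (D :^ 2 :* (y :+ ȳ)))) refl x y x̄ ȳ γ D ⟩
      F x x̄ - (y + γ * (D ^ 2 * (y + ȳ)))
        -- The second image is so far written with the D of `x`; the common value allows the
        -- exchange.
        ≈⟨ +-congˡ (-‿cong (+-congˡ (*-congˡ (*-congʳ (^-congˡ 2 D≈))))) ⟩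
      F x x̄ - F y ȳ
        ≈⟨ x≈y⇒x∙y⁻¹≈ε Fx≈Fy ⟩
      0# ∎

    conj-D : conj D ≈ - D
    conj-D = trans (conj-sub x x̄) (trans (+-congˡ (-‿cong (conj-conj x))) (sym (⁻¹-anti-homo‿- x x̄)))

    conj-sD : conj (s * D) ≈ - (s * D)
    conj-sD = trans (conj-* s D) (trans (*-cong s̄≈s conj-D) (sym (-‿distribʳ-* s D)))

    x≈y : x ≈ y
    x≈y = fromInj₁
      (λ 1-sD²≈0 → contradiction (sym (x∙y⁻¹≈ε⇒x≈y 1# ((s * D) ^ 2) 1-sD²≈0)) (antifixed-square≉1 conj-sD))
      (map₁ (x∙y⁻¹≈ε⇒x≈y x y) (x*y≈0⇒x≈0∨y≈0 {e} {1# - (s * D) ^ 2} factored))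

  square⇒permutation : ∀ γ → ∃[ a ] (ι a ≈ γ × K.IsSquare (K.- (2 K.· a))) → IsPermutation (f q L γ)
  square⇒permutation γ (a , ιa≈γ , s , -2a≈s²) = injective⇒bijective (f-cong γ)
    (square⇒injective γ (ι s) (trans (conj-cong (sym ιa≈γ)) (trans (conj-ι a) ιa≈γ)) (conj-ι s) (begin
      - (γ + γ)             ≈⟨ -‿cong (+-cong ιa≈γ ιa≈γ) ⟨
      - (ι a + ι a)         ≈⟨ ι[-2a] a ⟨
      ι (K.- (2 K.· a))     ≈⟨ ι.⟦⟧-cong -2a≈s² ⟩
      ι (s K.^ 2)           ≈⟨ ι-^ s 2 ⟩
      ι s ^ 2               ∎))

theorem3p6 : {c₁ ℓ₁ c₂ ℓ₂ : Level} (q : ℕ) → IsOddPrimePower q →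
    (K : FiniteField c₁ ℓ₁ q) (L : FiniteField c₂ ℓ₂ (q ℕ.^ 2)) →
    let module K = FiniteField K
        module L = FiniteField L
    in (ι : K.Carrier → L.Carrier) → IsEmbedding K L ι →
       (γ : L.Carrier) →
       L.IsPermutation (f q L γ) ⇔ (∃[ a ] (ι a L.≈ γ × K.IsSquare (K.- (2 K.· a))))
theorem3p6 q q-odd K L ι ι-embedding γ = mk⇔ (permutation⇒square γ) (square⇒permutation γ)
  where open QuadraticExtension q q-odd K L ι ι-embedding
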